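{- Let $t$ and $i$ be integers with $t \geq 1$, $0 \leq i < t$ and $t > 16i^{2} - i$. Let $H$ be a Hadamard matrix of order $4t+4i$, and let $M$ be the $(4t+4i) \times 4t$ matrix obtained from $H$ by deleting any $4i$ of its columns. Let $r_1, \dots, r_{4t+4i}$ be the rows of $M$, put $r_{4t+4i+j} = -r_j$ for $1 \leq j \leq 4t+4i$, and let $C_M = \{ \tfrac{1}{2}(r_j + \underline{1}) : 1 \leq j \leq 8t+8i\} \subseteq \{0,1\}^{4t}$, where $\underline{1}$ is the all-ones vector of length $4t$. Then the binary code $C_M$ is maximal: for every $v \in \{0,1\}^{4t} \setminus C_M$, the code $C_M \cup \{v\}$ has strictly smaller minimum distance than $C_M$.
   Context: A Hadamard matrix of order $n$ is an $n \times n$ matrix $H$ with entries in $\{\pm 1\}$ satisfying $HH^{\top} = nI_n$. A binary code of length $m$ is a subset of $\{0,1\}^m$; its minimum distance is the minimum Hamming distance between two distinct codewords. A code is called maximal if including any additional word as a codeword necessarily decreases the minimum distance. -}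

module Defs where

open import Algebra.Properties.Semiring.Sum using (sum)
open import Data.Bool.Base using (if_then_else_)
open import Data.Fin.Base using (Fin; toℕ)
open import Data.Fin.Properties using (_≟_)
open import Data.Integer.Base using (ℤ; +_; -_; _+_; _*_; _/_; 0ℤ; 1ℤ; -1ℤ)
open import Data.Integer.Properties using (+-*-semiring)
open import Data.Nat.Base as ℕ using (ℕ; _≤_; _<_)
open import Data.Product.Base using (_×_; _,_; ∃-syntax)
open import Data.Sum.Base using (_⊎_)
open import Data.Vec.Base using (Vec; lookup; zip; count)
open import Data.Vec.Functional as Vector using (Vector; transpose; _++_)
open import Level using (0ℓ)
open import Relation.Binary.PropositionalEquality using (_≡_; _≢_)
open import Relation.Nullary.Decidable using (does; ¬?)
open import Relation.Unary using (Pred; _∈_; _∉_; _∪_; ｛_｝)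

Matrix : ℕ → ℕ → Set
Matrix m n = Vector (Vector ℤ n) m

infixl 7 _*ᴹ_

_*ᴹ_ : ∀ {m n p} → Matrix m n → Matrix n p → Matrix m p
(A *ᴹ B) j k = sum +-*-semiring (λ l → A j l * B l k)

scalarMatrix : ℤ → ∀ n → Matrix n n
scalarMatrix c n j k = if does (j ≟ k) then c else 0ℤ

record IsHadamard (n : ℕ) (H : Matrix n n) : Set where
  field
    entries : ∀ j k → H j k ≡ 1ℤ ⊎ H j k ≡ -1ℤ
    HHᵀ≡nI  : ∀ j k → (H *ᴹ transpose H) j k ≡ scalarMatrix (+ n) n j k

-- Deletion of columns is presented by the increasing enumeration σ of the
-- columns that are kept.
keepColumns : ∀ {m n p} → (Fin p → Fin n) → Matrix m n → Matrix m p
keepColumns σ A j k = A j (σ k)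

withNegatedRows : ∀ {m n} → Matrix m n → Matrix (m ℕ.+ m) n
withNegatedRows A = A ++ Vector.map (Vector.map -_) A

Word : ℕ → Set
Word m = Vec (Fin 2) m

Code : ℕ → Set₁
Code m = Pred (Word m) 0ℓ

hamming : ∀ {m} → Word m → Word m → ℕ
hamming x y = count (λ (a , b) → ¬? (a ≟ b)) (zip x y)

record IsMinimumDistance {m : ℕ} (C : Code m) (d : ℕ) : Set where
  field
    attained   : ∃[ x ] ∃[ y ] (x ∈ C × y ∈ C × x ≢ y × hamming x y ≡ d)
    lowerBound : ∀ x y → x ∈ C → y ∈ C → x ≢ y → d ≤ hamming x y

-- The minimum distances are asserted to exist, so a code with fewer than two
-- words is not maximal.
Maximal : ∀ {m} → Code m → Set
Maximal C = ∃[ d ] (IsMinimumDistance C d ×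
  (∀ v → v ∉ C → ∃[ d′ ] (IsMinimumDistance (C ∪ ｛ v ｝) d′ × d′ < d)))

-- The words ½(r + 1), for r a row of M or the negative of one. The division is
-- exact when the entries of M are ±1.
codeOf : ∀ {n m} → Matrix n m → Code m
codeOf M w = ∃[ j ] ∀ l →
  + toℕ (lookup w l) ≡ (withNegatedRows M j l + 1ℤ) / (+ 2)

{-# OPTIONS --safe #-}
module Submission where

-- Identify words with ±1 vectors, so that 2 · hamming x y = 4t − ⟨x, y⟩. Two
-- distinct codewords come from opposite or orthogonal signed rows of H,
-- and deleting 4i columns lets their inner product grow to at most 4i. On the
-- other hand HᵀH = nI with n = 4t + 4i, so every ±1 vector v of length 4t has
-- Σⱼ ⟨v, rⱼ⟩² = n · 4t, and since 16i² < 4t some signed row has inner product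
-- larger than 4i with v: it is closer to v than the minimum distance.
--
-- HᵀH = nI is obtained from HHᵀ = nI without inverting matrices: HᵀH and HHᵀ
-- have the same sum of squared entries, n³, and this is already the
-- contribution of the diagonal of HᵀH.

open import Defs
open import Data.Fin.Base as Fin using (Fin; zero; suc; toℕ; _↑ˡ_; _↑ʳ_; splitAt; punchIn; punchOut)
open import Data.Fin.Properties as Finₚ using (_≟_; any?)
open import Data.Fin.Patterns using (0F; 1F)
open import Data.Integer.Base as ℤ using (ℤ; +_; 0ℤ; 1ℤ; -1ℤ)
import Data.Integer.Properties as ℤₚ
open import Data.Integer.Tactic.RingSolver using (solve-∀)
open import Data.Nat.Base as ℕ using (ℕ; z≤n)
open import Data.Nat.Induction using (<-wellFounded)
import Data.Nat.Properties as ℕₚ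
open import Data.Product.Base using (_×_; _,_; ∃-syntax)
open import Data.Sum.Base using (_⊎_; inj₁; inj₂)
open import Data.Vec.Base using ([]; _∷_; lookup; tabulate)
open import Data.Vec.Properties using (≡-dec; lookup∘tabulate; tabulate∘lookup; tabulate-cong)
open import Data.Vec.Functional as Vector using (Vector; transpose; removeAt)
open import Data.Vec.Functional.Properties using (lookup-++ˡ; lookup-++ʳ)
open import Function.Base using (_∘_)
open import Function.Definitions using (Injective)
open import Induction.WellFounded using (Acc; acc)
open import Relation.Binary.Core using (_Preserves_⟶_)
open import Relation.Binary.Definitions using (tri<; tri≈; tri>)
open import Relation.Binary.PropositionalEquality
open import Relation.Nullary.Decidable using (yes; no; ¬?; _×-dec_; dec-true; dec-false)
open import Relation.Nullary.Negation using (contradiction)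
open import Relation.Unary using (_∈_; _∪_; ｛_｝)

-- Finite sums of integers, inner products and Gram matrices.

module IntegerSums where

  open import Data.Integer.Base using (_+_; _*_; -_; _≤_)
  open import Algebra.Properties.Semiring.Sum ℤₚ.+-*-semiring public
    using (sum; sum-cong-≗; sum-remove; ∑-distrib-+; ∑-comm; *-distribˡ-sum; *-distribʳ-sum)

  0≤i*i : ∀ i → 0ℤ ≤ i * i
  0≤i*i (+ n)      = subst (0ℤ ≤_) (ℤₚ.pos-* n n) (ℤ.+≤+ z≤n)
  0≤i*i ℤ.-[1+ n ] = ℤ.+≤+ z≤n

  i*i≤0⇒i≡0 : ∀ i → i * i ≤ 0ℤ → i ≡ 0ℤ
  i*i≤0⇒i≡0 i i²≤0 with ℤₚ.i*j≡0⇒i≡0∨j≡0 i (ℤₚ.≤-antisym i²≤0 (0≤i*i i))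
  ... | inj₁ i≡0 = i≡0
  ... | inj₂ i≡0 = i≡0

  sum-mono-≤ : ∀ {n} {f g : Vector ℤ n} → (∀ k → f k ≤ g k) → sum f ≤ sum g
  sum-mono-≤ {ℕ.zero}  f≤g = ℤₚ.≤-refl
  sum-mono-≤ {ℕ.suc n} f≤g = ℤₚ.+-mono-≤ (f≤g zero) (sum-mono-≤ (f≤g ∘ suc))

  -- A single strict term would make the comparison of the totals strict. This turns a bound on the
  -- total of the squared entries into a bound on each entry.
  sum-mono-≤-tight : ∀ {n} {f g : Vector ℤ n} → (∀ k → f k ≤ g k) →
                     sum g ≤ sum f → ∀ k → g k ≤ f k
  sum-mono-≤-tight f≤g ∑g≤∑f zero = ℤₚ.≮⇒≥ λ f₀<g₀ →
    ℤₚ.<⇒≱ (ℤₚ.+-mono-<-≤ f₀<g₀ (sum-mono-≤ (f≤g ∘ suc))) ∑g≤∑f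
  sum-mono-≤-tight f≤g ∑g≤∑f (suc k) = sum-mono-≤-tight (f≤g ∘ suc)
    (ℤₚ.≮⇒≥ λ ∑f<∑g → ℤₚ.<⇒≱ (ℤₚ.+-mono-≤-< (f≤g zero) ∑f<∑g) ∑g≤∑f) k

  sum-const : ∀ n c → sum {n} (λ _ → c) ≡ + n * c
  sum-const ℕ.zero    c = sym (ℤₚ.*-zeroˡ c)
  sum-const (ℕ.suc n) c = trans (cong (_+_ c) (sum-const n c)) (sym (ℤₚ.suc-* (+ n) c))

  -- Induction on `p`: once `σ zero` is split off, injectivity lets the other indices factor through
  -- `punchIn`, as an injection into one index fewer. The terms missed at the end are nonnegative.
  sum-injection-≤ : ∀ {p n} {f : Vector ℤ n} {σ : Fin p → Fin n} → Injective _≡_ _≡_ σ →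
                    (∀ k → 0ℤ ≤ f k) → sum (f ∘ σ) ≤ sum f
  sum-injection-≤ {ℕ.zero} {n} {f} σ-inj 0≤f = begin
    0ℤ                ≡⟨ ℤₚ.*-zeroʳ (+ n) ⟨
    + n * 0ℤ          ≡⟨ sum-const n 0ℤ ⟨
    sum {n} (λ _ → 0ℤ) ≤⟨ sum-mono-≤ 0≤f ⟩
    sum f             ∎
    where open ℤₚ.≤-Reasoning
  sum-injection-≤ {ℕ.suc p} {ℕ.zero} {σ = σ} σ-inj 0≤f with () ← σ zero
  sum-injection-≤ {ℕ.suc p} {ℕ.suc n} {f} {σ} σ-inj 0≤f = begin
    f i + sum (f ∘ σ ∘ suc)
      ≡⟨ cong (_+_ (f i)) (sum-cong-≗ λ k → cong f (Finₚ.punchIn-punchOut (i≢ k))) ⟨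
    f i + sum (removeAt f i ∘ τ)
      ≤⟨ ℤₚ.+-monoʳ-≤ (f i) (sum-injection-≤ τ-inj (0≤f ∘ punchIn i)) ⟩
    f i + sum (removeAt f i)
      ≡⟨ sum-remove f ⟨
    sum f ∎
    where
    open ℤₚ.≤-Reasoning
    i = σ zero
    i≢ : ∀ k → i ≢ σ (suc k)
    i≢ k eq = Finₚ.0≢1+n (σ-inj eq)
    τ = λ k → punchOut (i≢ k)
    τ-inj : Injective _≡_ _≡_ τ
    τ-inj eq = Finₚ.suc-injective (σ-inj (Finₚ.punchOut-injective (i≢ _) (i≢ _) eq))

  sum-*-sum : ∀ {m n} (f : Vector ℤ m) (g : Vector ℤ n) →
              sum f * sum g ≡ sum (λ j → sum (λ k → f j * g k))
  sum-*-sum f g = trans (*-distribʳ-sum (sum g) f) (sum-cong-≗ λ j → *-distribˡ-sum (f j) g)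

  ∑∑∑-comm : ∀ {m n p} (f : Fin m → Fin n → Fin p → ℤ) →
             sum (λ k → sum (λ l → sum (f k l))) ≡
             sum (λ j → sum (λ k → sum (λ l → f k l j)))
  ∑∑∑-comm f = trans (sum-cong-≗ λ k → ∑-comm (f k)) (∑-comm (λ k j → sum (λ l → f k l j)))

  infix 8 _∙_

  _∙_ : ∀ {n} → Vector ℤ n → Vector ℤ n → ℤ
  f ∙ g = sum (λ l → f l * g l)

  ∙-cong : ∀ {n} {f f′ g g′ : Vector ℤ n} → f ≗ f′ → g ≗ g′ → f ∙ g ≡ f′ ∙ g′
  ∙-cong f≗f′ g≗g′ = sum-cong-≗ λ l → cong₂ _*_ (f≗f′ l) (g≗g′ l)

  ∙-negʳ : ∀ {n} (f g : Vector ℤ n) → f ∙ (λ l → - g l) ≡ - (f ∙ g)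
  ∙-negʳ {ℕ.zero}  f g = refl
  ∙-negʳ {ℕ.suc n} f g = trans
    (cong₂ _+_ (sym (ℤₚ.neg-distribʳ-* (f zero) (g zero))) (∙-negʳ (f ∘ suc) (g ∘ suc)))
    (sym (ℤₚ.neg-distrib-+ (f zero * g zero) _))

  ∙-comm : ∀ {n} (f g : Vector ℤ n) → f ∙ g ≡ g ∙ f
  ∙-comm f g = sum-cong-≗ λ l → ℤₚ.*-comm (f l) (g l)

  -- Both Gram matrices expand to the same fourfold sum, over two row indices and two column
  -- indices, of the product of the four entries of `A` at their crossings.
  *ᴹ-transpose-norm : ∀ {m n} (A : Matrix m n) →
    sum (λ k → sum λ l → (transpose A *ᴹ A) k l * (transpose A *ᴹ A) k l) ≡
    sum (λ i → sum λ j → (A *ᴹ transpose A) i j * (A *ᴹ transpose A) i j)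
  *ᴹ-transpose-norm A = begin
    sum (λ k → sum λ l → (transpose A *ᴹ A) k l * (transpose A *ᴹ A) k l)
      ≡⟨ sum-cong-≗ (λ k → sum-cong-≗ λ l → sum-*-sum (λ i → A i k * A i l) (λ j → A j k * A j l)) ⟩
    sum (λ k → sum λ l → sum λ i → sum λ j → (A i k * A i l) * (A j k * A j l))
      -- This exchange and the next one each carry a row index outward past both column indices.
      ≡⟨ ∑∑∑-comm (λ k l i → sum λ j → (A i k * A i l) * (A j k * A j l)) ⟩
    sum (λ i → sum λ k → sum λ l → sum λ j → (A i k * A i l) * (A j k * A j l))
      ≡⟨ sum-cong-≗ (λ i → ∑∑∑-comm (λ k l j → (A i k * A i l) * (A j k * A j l))) ⟩
    sum (λ i → sum λ j → sum λ k → sum λ l → (A i k * A i l) * (A j k * A j l))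
      ≡⟨ sum-cong-≗ (λ i → sum-cong-≗ λ j → sum-cong-≗ λ k → sum-cong-≗ λ l →
           interchange (A i k) (A i l) (A j k) (A j l)) ⟩
    sum (λ i → sum λ j → sum λ k → sum λ l → (A i k * A j k) * (A i l * A j l))
      ≡⟨ sum-cong-≗ (λ i → sum-cong-≗ λ j → sum-*-sum (λ k → A i k * A j k) (λ l → A i l * A j l)) ⟨
    sum (λ i → sum λ j → (A *ᴹ transpose A) i j * (A *ᴹ transpose A) i j) ∎
    where
    open ≡-Reasoning
    interchange : ∀ a b c d → (a * b) * (c * d) ≡ (a * c) * (b * d)
    interchange = solve-∀

  scalarMatrix-diagonal : ∀ c {n} (k : Fin n) → scalarMatrix c n k k ≡ c
  scalarMatrix-diagonal c k rewrite dec-true (k ≟ k) refl = refl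

  scalarMatrix-off-diagonal : ∀ c {n} {k l : Fin n} → k ≢ l → scalarMatrix c n k l ≡ 0ℤ
  scalarMatrix-off-diagonal c {k = k} {l} k≢l rewrite dec-false (k ≟ l) k≢l = refl

  scalarMatrix-nonneg : ∀ c {n} (k l : Fin n) → 0ℤ ≤ scalarMatrix (+ c) n k l
  scalarMatrix-nonneg c k l with k ≟ l
  ... | yes _ = ℤ.+≤+ z≤n
  ... | no  _ = ℤₚ.≤-refl

  scalarMatrix-∙ : ∀ c {n} (k : Fin n) (f : Vector ℤ n) → scalarMatrix c n k ∙ f ≡ c * f k
  scalarMatrix-∙ c {ℕ.suc n} zero f = begin
    c * f zero + sum (λ l → 0ℤ * f (suc l)) ≡⟨ cong (_+_ (c * f zero)) (sum-cong-≗ λ l → ℤₚ.*-zeroˡ (f (suc l))) ⟩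
    c * f zero + sum {n} (λ _ → 0ℤ)         ≡⟨ cong (_+_ (c * f zero)) (trans (sum-const n 0ℤ) (ℤₚ.*-zeroʳ (+ n))) ⟩
    c * f zero + 0ℤ                         ≡⟨ ℤₚ.+-identityʳ _ ⟩
    c * f zero                              ∎
    where open ≡-Reasoning
  scalarMatrix-∙ c {ℕ.suc n} (suc k) f =
    trans (cong₂ _+_ (ℤₚ.*-zeroˡ (f zero)) (scalarMatrix-∙ c k (f ∘ suc))) (ℤₚ.+-identityˡ _)

  -- Expanding the squares and summing over the rows first leaves the quadratic form of the Gram
  -- matrix of the columns, evaluated at `v`. `M` may be rectangular: only its columns have to be
  -- orthogonal.
  parseval : ∀ {n p} c (M : Matrix n p) →
             (∀ k l → (transpose M *ᴹ M) k l ≡ scalarMatrix c p k l) →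
             ∀ v → sum (λ j → v ∙ M j * v ∙ M j) ≡ c * v ∙ v
  parseval {p = p} c M MᵀM≡cI v = begin
    sum (λ j → v ∙ M j * v ∙ M j)
      ≡⟨ sum-cong-≗ (λ j → sum-*-sum (λ k → v k * M j k) (λ l → v l * M j l)) ⟩
    sum (λ j → sum λ k → sum λ l → (v k * M j k) * (v l * M j l))
      ≡⟨ ∑∑∑-comm (λ k l j → (v k * M j k) * (v l * M j l)) ⟨
    sum (λ k → sum λ l → sum λ j → (v k * M j k) * (v l * M j l))
      ≡⟨ sum-cong-≗ (λ k → sum-cong-≗ (entry k)) ⟩
    sum (λ k → sum λ l → scalarMatrix c p k l * (v k * v l))
      ≡⟨ sum-cong-≗ (λ k → scalarMatrix-∙ c k (λ l → v k * v l)) ⟩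
    sum (λ k → c * (v k * v k))
      ≡⟨ *-distribˡ-sum c (λ k → v k * v k) ⟨
    c * v ∙ v ∎
    where
    open ≡-Reasoning
    interchange : ∀ a b c d → (a * b) * (c * d) ≡ (b * d) * (a * c)
    interchange = solve-∀
    entry : ∀ k l → sum (λ j → (v k * M j k) * (v l * M j l)) ≡ scalarMatrix c p k l * (v k * v l)
    entry k l = begin
      sum (λ j → (v k * M j k) * (v l * M j l))  ≡⟨ sum-cong-≗ (λ j → interchange (v k) (M j k) (v l) (M j l)) ⟩
      sum (λ j → (M j k * M j l) * (v k * v l))  ≡⟨ *-distribʳ-sum (v k * v l) (λ j → M j k * M j l) ⟨
      (transpose M *ᴹ M) k l * (v k * v l)       ≡⟨ cong (_* (v k * v l)) (MᵀM≡cI k l) ⟩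
      scalarMatrix c p k l * (v k * v l)         ∎

-- Vectors with entries 1 and -1.

module SignVectors where

  open IntegerSums
  open import Data.Integer.Base using (_+_; _*_; -_; _-_; _≤_; _<_)

  IsSign : ℤ → Set
  IsSign a = a ≡ 1ℤ ⊎ a ≡ -1ℤ

  sign-square : ∀ {a} → IsSign a → a * a ≡ 1ℤ
  sign-square (inj₁ refl) = refl
  sign-square (inj₂ refl) = refl

  neg-sign : ∀ {a} → IsSign a → IsSign (- a)
  neg-sign (inj₁ refl) = inj₂ refl
  neg-sign (inj₂ refl) = inj₁ refl

  sign≢neg : ∀ {a} → IsSign a → a ≢ - a
  sign≢neg (inj₁ refl) ()
  sign≢neg (inj₂ refl) ()

  sign-product≥-1 : ∀ {a b} → IsSign a → IsSign b → -1ℤ ≤ a * b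
  sign-product≥-1 (inj₁ refl) (inj₁ refl) = ℤ.-≤+
  sign-product≥-1 (inj₁ refl) (inj₂ refl) = ℤₚ.≤-refl
  sign-product≥-1 (inj₂ refl) (inj₁ refl) = ℤₚ.≤-refl
  sign-product≥-1 (inj₂ refl) (inj₂ refl) = ℤ.-≤+

  sign-vector-norm : ∀ {n} {v : Vector ℤ n} → (∀ l → IsSign (v l)) → v ∙ v ≡ + n
  sign-vector-norm {n} v± =
    trans (sum-cong-≗ (sign-square ∘ v±)) (trans (sum-const n 1ℤ) (ℤₚ.*-identityʳ (+ n)))

  -- Adding 1 to every term makes all terms nonnegative, so discarding those outside the image of
  -- `σ` cannot increase the shifted sum. With `f` the entrywise product of two sign rows, this
  -- controls what deleting columns does to their inner product.
  sum-injection-excess : ∀ {p n} {f : Vector ℤ n} {σ : Fin p → Fin n} → Injective _≡_ _≡_ σ →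
                         (∀ l → -1ℤ ≤ f l) → sum f ≤ 0ℤ → + p + sum (f ∘ σ) ≤ + n
  sum-injection-excess {p} {n} {f} {σ} σ-inj -1≤f ∑f≤0 = begin
    + p + sum (f ∘ σ)           ≡⟨ shifted p (f ∘ σ) ⟨
    sum (λ k → 1ℤ + f (σ k))    ≤⟨ sum-injection-≤ σ-inj (λ l → ℤₚ.+-monoʳ-≤ 1ℤ (-1≤f l)) ⟩
    sum (λ l → 1ℤ + f l)        ≡⟨ shifted n f ⟩
    + n + sum f                 ≤⟨ ℤₚ.+-monoʳ-≤ (+ n) ∑f≤0 ⟩
    + n + 0ℤ                    ≡⟨ ℤₚ.+-identityʳ (+ n) ⟩
    + n                         ∎
    where
    open ℤₚ.≤-Reasoning
    shifted : ∀ q (g : Vector ℤ q) → sum (λ l → 1ℤ + g l) ≡ + q + sum g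
    shifted q g = trans (∑-distrib-+ (λ _ → 1ℤ) g)
      (cong (_+ sum g) (trans (sum-const q 1ℤ) (ℤₚ.*-identityʳ (+ q))))

  withNegatedRows-sign : ∀ {n p} {A : Matrix n p} → (∀ j k → IsSign (A j k)) →
                         ∀ J k → IsSign (withNegatedRows A J k)
  withNegatedRows-sign {n} A± J k with splitAt n J
  ... | inj₁ j = A± j k
  ... | inj₂ j = neg-sign (A± j k)

  withNegatedRows-keepColumns : ∀ {m n p} (σ : Fin p → Fin n) (A : Matrix m n) J k →
    withNegatedRows (keepColumns σ A) J k ≡ withNegatedRows A J (σ k)
  withNegatedRows-keepColumns {m} σ A J k with splitAt m J
  ... | inj₁ _ = refl
  ... | inj₂ _ = refl

  -- If no signed row exceeded `b`, the sum of the `n` squares would be at most `n` times `b * b`,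
  -- and hence below `n` times `c`.
  signedRow-exceeding : ∀ {n p} c b (M : Matrix n p) (v : Vector ℤ p) →
    sum (λ j → v ∙ M j * v ∙ M j) ≡ + n * c → b * b < c → 0 ℕ.< n →
    ∃[ J ] b < v ∙ withNegatedRows M J
  signedRow-exceeding {n@(ℕ.suc _)} c b M v ∑≡nc b²<c _
    with any? (λ J → b ℤₚ.<? v ∙ withNegatedRows M J)
  ... | yes found = found
  ... | no  none  = contradiction
    (ℤₚ.≤-trans (ℤₚ.≤-reflexive (sym ∑≡nc))
      (ℤₚ.≤-trans (sum-mono-≤ square-≤) (ℤₚ.≤-reflexive (sum-const n (b * b)))))
    (ℤₚ.<⇒≱ (ℤₚ.*-monoˡ-<-pos (+ n) b²<c))
    where
    bound : ∀ J → v ∙ withNegatedRows M J ≤ b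
    bound J = ℤₚ.≮⇒≥ (λ b< → none (J , b<))
    square-≤ : ∀ j → v ∙ M j * v ∙ M j ≤ b * b
    -- The difference of squares factors as `(b - x) * (b + x)`. The bound on row `j` makes the
    -- first factor nonnegative, and the bound on its negation the second.
    square-≤ j = ℤₚ.0≤i-j⇒j≤i (subst (0ℤ ≤_) (factor b (v ∙ M j))
      (ℤₚ.*-monoʳ-≤-nonNeg (b + v ∙ M j) ⦃ ℤ.nonNegative 0≤b+x ⦄ 0≤b-x))
      where
      factor : ∀ b x → (b - x) * (b + x) ≡ b * b - x * x
      factor = solve-∀
      0≤b-x : 0ℤ ≤ b - v ∙ M j
      0≤b-x = ℤₚ.i≤j⇒0≤j-i (subst (λ r → v ∙ r ≤ b) (lookup-++ˡ M _ j) (bound (j ↑ˡ n)))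
      -x≤b : - (v ∙ M j) ≤ b
      -x≤b = subst (_≤ b) (∙-negʳ v (M j)) (subst (λ r → v ∙ r ≤ b) (lookup-++ʳ M _ j) (bound (n ↑ʳ j)))
      0≤b+x : 0ℤ ≤ b + v ∙ M j
      0≤b+x = subst (0ℤ ≤_) (cong (_+_ b) (ℤₚ.neg-involutive (v ∙ M j))) (ℤₚ.i≤j⇒0≤j-i -x≤b)

-- Column orthogonality and signed rows of a Hadamard matrix.

module Hadamard {n : ℕ} {H : Matrix n n} (hadamard : IsHadamard n H) where

  open IntegerSums
  open SignVectors
  open import Data.Integer.Base using (_*_; -_; _≤_)
  open IsHadamard hadamard

  HᵀH≡nI : ∀ k l → (transpose H *ᴹ H) k l ≡ scalarMatrix (+ n) n k l
  HᵀH≡nI k l with k ≟ l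
  ... | yes refl = sign-vector-norm (λ j → entries j k)
  ... | no  k≢l  = i*i≤0⇒i≡0 (E k l)
    (subst (λ s → E k l * E k l ≤ s * s) (scalarMatrix-off-diagonal (+ n) k≢l) (E²≤S² k l))
    where
    E S : Matrix n n
    E = transpose H *ᴹ H
    S = scalarMatrix (+ n) n
    -- The two agree on the diagonal, because the columns are sign vectors of length `n`; elsewhere
    -- `S` vanishes.
    S²≤E² : ∀ k l → S k l * S k l ≤ E k l * E k l
    S²≤E² k l with k ≟ l
    ... | yes refl = ℤₚ.≤-reflexive (cong (λ e → e * e) (sym (sign-vector-norm (λ j → entries j k))))
    ... | no  _    = 0≤i*i (E k l)
    ∑E²≤∑S² : sum (λ k → sum λ l → E k l * E k l) ≤ sum (λ k → sum λ l → S k l * S k l)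
    ∑E²≤∑S² = ℤₚ.≤-reflexive (trans (*ᴹ-transpose-norm H)
      (sum-cong-≗ λ i → sum-cong-≗ λ j → cong (λ e → e * e) (HHᵀ≡nI i j)))
    E²≤S² : ∀ k l → E k l * E k l ≤ S k l * S k l
    -- Tightness is used twice: on the sum over rows, to compare the row totals, and then within row
    -- `k`.
    E²≤S² k = sum-mono-≤-tight (S²≤E² k)
      (sum-mono-≤-tight (λ k → sum-mono-≤ (S²≤E² k)) ∑E²≤∑S² k)

  -- Signed rows with different underlying rows are orthogonal; those with the same underlying row
  -- are equal or opposite.
  signedRows-product : ∀ J K → withNegatedRows H J ≗ withNegatedRows H K ⊎
                       withNegatedRows H J ∙ withNegatedRows H K ≤ 0ℤ
  signedRows-product J K with splitAt n J | splitAt n K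
  ... | inj₁ j | inj₁ k with j ≟ k
  ...   | yes refl = inj₁ λ _ → refl
  ...   | no  j≢k  = inj₂ (ℤₚ.≤-reflexive (trans (HHᵀ≡nI j k) (scalarMatrix-off-diagonal (+ n) j≢k)))
  -- With opposite signs the product is minus an entry of `nI`, which is nonpositive whether or not
  -- `j` and `k` coincide.
  signedRows-product J K | inj₁ j | inj₂ k = inj₂ (subst (_≤ 0ℤ)
    (sym (trans (∙-negʳ (H j) (H k)) (cong -_ (HHᵀ≡nI j k))))
    (ℤₚ.neg-mono-≤ (scalarMatrix-nonneg n j k)))
  signedRows-product J K | inj₂ j | inj₁ k = inj₂ (subst (_≤ 0ℤ)
    (sym (trans (∙-comm (λ l → - H j l) (H k)) (trans (∙-negʳ (H k) (H j)) (cong -_ (HHᵀ≡nI k j)))))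
    (ℤₚ.neg-mono-≤ (scalarMatrix-nonneg n k j)))
  signedRows-product J K | inj₂ j | inj₂ k with j ≟ k
  ...   | yes refl = inj₁ λ _ → refl
  ...   | no  j≢k  = inj₂ (ℤₚ.≤-reflexive (begin
    (λ l → - H j l) ∙ (λ l → - H k l)  ≡⟨ sum-cong-≗ (λ l → neg-*-neg (H j l) (H k l)) ⟩
    H j ∙ H k                          ≡⟨ HHᵀ≡nI j k ⟩
    scalarMatrix (+ n) n j k           ≡⟨ scalarMatrix-off-diagonal (+ n) j≢k ⟩
    0ℤ                                 ∎))
    where
    open ≡-Reasoning
    neg-*-neg : ∀ a b → - a * - b ≡ a * b
    neg-*-neg = solve-∀

-- Binary words as sign vectors, minimum distance and maximality.

module Words where

  open IntegerSums
  open SignVectors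
  open import Data.Integer.Base using (_+_; _*_; -_; _<_; _/_)

  sign : Fin 2 → ℤ
  sign 0F = -1ℤ
  sign 1F = 1ℤ

  bit : ℤ → Fin 2
  bit a with a ℤₚ.≟ 1ℤ
  ... | yes _ = 1F
  -- A default for every integer other than 1; on signs it is reached only by -1.
  ... | no  _ = 0F

  sign-isSign : ∀ a → IsSign (sign a)
  sign-isSign 0F = inj₂ refl
  sign-isSign 1F = inj₁ refl

  bit-sign : ∀ a → bit (sign a) ≡ a
  bit-sign 0F = refl
  bit-sign 1F = refl

  sign-bit : ∀ {a} → IsSign a → sign (bit a) ≡ a
  sign-bit (inj₁ refl) = refl
  sign-bit (inj₂ refl) = refl

  sign⇒half : ∀ a → + toℕ a ≡ (sign a + 1ℤ) / + 2
  sign⇒half 0F = refl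
  sign⇒half 1F = refl

  -- Integer division rounds, so the quotient determines `b` only because `b` is known to be a sign.
  half⇒sign : ∀ a {b} → IsSign b → + toℕ a ≡ (b + 1ℤ) / + 2 → sign a ≡ b
  half⇒sign 0F (inj₁ refl) ()
  half⇒sign 0F (inj₂ refl) _  = refl
  half⇒sign 1F (inj₁ refl) _  = refl
  half⇒sign 1F (inj₂ refl) ()

  signs : ∀ {m} → Word m → Vector ℤ m
  signs w l = sign (lookup w l)

  signs-injective : ∀ {m} {x y : Word m} → signs x ≗ signs y → x ≡ y
  signs-injective {x = x} {y} eq = begin
    x                                ≡⟨ tabulate∘lookup x ⟨
    tabulate (lookup x)              ≡⟨ tabulate-cong (λ l → bit-sign (lookup x l)) ⟨
    tabulate (λ l → bit (signs x l)) ≡⟨ tabulate-cong (λ l → cong bit (eq l)) ⟩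
    tabulate (λ l → bit (signs y l)) ≡⟨ tabulate-cong (λ l → bit-sign (lookup y l)) ⟩
    tabulate (lookup y)              ≡⟨ tabulate∘lookup y ⟩
    y                                ∎
    where open ≡-Reasoning

  -- A position of agreement adds 1 to the inner product and 0 to the distance; a position of
  -- difference adds -1 and 1. Either way the left side grows by 1.
  signs-∙ : ∀ {m} (x y : Word m) → signs x ∙ signs y + + 2 * + hamming x y ≡ + m
  signs-∙ [] [] = refl
  signs-∙ {ℕ.suc m} (a ∷ x) (b ∷ y) = trans (step a b) (cong (_+_ 1ℤ) (signs-∙ x y))
    where
    S = signs x ∙ signs y
    agree : ∀ s h → 1ℤ + s + + 2 * h ≡ 1ℤ + (s + + 2 * h)
    agree = solve-∀
    differ : ∀ s h → -1ℤ + s + + 2 * (1ℤ + h) ≡ 1ℤ + (s + + 2 * h)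
    differ = solve-∀
    step : ∀ a b → signs (a ∷ x) ∙ signs (b ∷ y) + + 2 * + hamming (a ∷ x) (b ∷ y) ≡
                   1ℤ + (S + + 2 * + hamming x y)
    step 0F 0F = agree S (+ hamming x y)
    step 0F 1F = differ S (+ hamming x y)
    step 1F 0F = differ S (+ hamming x y)
    step 1F 1F = agree S (+ hamming x y)

  hamming-reverses-∙ : ∀ {m} (x y v c : Word m) → signs x ∙ signs y < signs v ∙ signs c →
                       hamming v c ℕ.< hamming x y
  hamming-reverses-∙ x y v c xy<vc = ℕₚ.≰⇒> λ hxy≤hvc → ℤₚ.<-irrefl
    (trans (signs-∙ x y) (sym (signs-∙ v c)))
    (ℤₚ.+-mono-<-≤ xy<vc (ℤₚ.*-monoˡ-≤-nonNeg (+ 2) (ℤ.+≤+ hxy≤hvc)))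

  -- A code is an arbitrary predicate, so a finite listing is what makes the search for a closest
  -- pair decidable. Repetitions are allowed.
  record Enumeration {m} (C : Code m) : Set where
    field
      {size}   : ℕ
      word     : Fin size → Word m
      word∈    : ∀ j → word j ∈ C
      complete : ∀ {w} → w ∈ C → ∃[ j ] word j ≡ w

  enumerate-∪-｛｝ : ∀ {m} {C : Code m} v → Enumeration C → Enumeration (C ∪ ｛ v ｝)
  enumerate-∪-｛｝ v e = record
    { word     = v Vector.∷ word
    ; word∈    = λ { zero → inj₂ refl ; (suc j) → inj₁ (word∈ j) }
    ; complete = λ { (inj₁ w∈C) → let j , eq = complete w∈C in suc j , eq
                   ; (inj₂ v≡w) → zero , v≡w }
    }
    where open Enumeration e

  -- Descent on the distance: a pair of distinct codewords is replaced by a strictly closer one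
  -- until the search through the enumeration finds none.
  minimumDistance : ∀ {m} {C : Code m} → Enumeration C → ∀ {x y} → x ∈ C → y ∈ C → x ≢ y →
                    ∃[ d ] IsMinimumDistance C d
  minimumDistance {m} {C} e {x} {y} = search (<-wellFounded (hamming x y))
    where
    open Enumeration e
    search : ∀ {x y} → Acc ℕ._<_ (hamming x y) → x ∈ C → y ∈ C → x ≢ y → ∃[ d ] IsMinimumDistance C d
    search {x} {y} (acc rec) x∈C y∈C x≢y
      with any? (λ j → any? λ k → ¬? (≡-dec _≟_ (word j) (word k)) ×-dec
                                  (hamming (word j) (word k) ℕₚ.<? hamming x y))
    ... | yes (j , k , j≢k , closer) = search (rec closer) (word∈ j) (word∈ k) j≢k
    ... | no  none = hamming x y , record
      { attained   = x , y , x∈C , y∈C , x≢y , refl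
      ; lowerBound = minimal
      }
      where
      minimal : ∀ u w → u ∈ C → w ∈ C → u ≢ w → hamming x y ℕ.≤ hamming u w
      minimal u w u∈C w∈C u≢w with complete u∈C | complete w∈C
      ... | j , refl | k , refl = ℕₚ.≮⇒≥ λ closer → none (j , k , u≢w , closer)

  -- The given `c` is closer to `v` than the pair attaining the old minimum distance. Since `c` is a
  -- codeword and `v` is not, they are distinct, and their distance bounds the new minimum from
  -- above.
  maximal : ∀ {m} {C : Code m} → Enumeration C → ∀ {x y} → x ∈ C → y ∈ C → x ≢ y →
            (∀ v → ∃[ c ] (c ∈ C × ∀ {x y} → x ∈ C → y ∈ C → x ≢ y → hamming v c ℕ.< hamming x y)) →
            Maximal C
  maximal {C = C} e x∈C y∈C x≢y close with minimumDistance e x∈C y∈C x≢y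
  ... | d , isMin with IsMinimumDistance.attained isMin
  ...   | a , b , a∈C , b∈C , a≢b , refl = d , isMin , λ v v∉C →
    let d′ , isMin′ = minimumDistance (enumerate-∪-｛｝ v e) (inj₁ x∈C) (inj₁ y∈C) x≢y
        c , c∈C , closer = close v
        v≢c = λ v≡c → v∉C (subst C (sym v≡c) c∈C)
    in d′ , isMin′ , ℕₚ.≤-<-trans
         (IsMinimumDistance.lowerBound isMin′ v c (inj₂ refl) (inj₁ c∈C) v≢c)
         (closer a∈C b∈C a≢b)

  -- The code of a sign matrix, enumerated by its signed rows.

  module RowCode {n m} {M : Matrix n m} (M± : ∀ j l → IsSign (M j l)) where

    ∈⇒signs : ∀ w → w ∈ codeOf M → ∃[ J ] signs w ≗ withNegatedRows M J
    ∈⇒signs w (J , eq) = J , λ l → half⇒sign (lookup w l) (withNegatedRows-sign M± J l) (eq l)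

    signs⇒∈ : ∀ w J → signs w ≗ withNegatedRows M J → w ∈ codeOf M
    signs⇒∈ w J eq = J , λ l →
      trans (sign⇒half (lookup w l)) (cong (λ a → (a + 1ℤ) / + 2) (eq l))

    rowWord : Fin (n ℕ.+ n) → Word m
    rowWord J = tabulate (bit ∘ withNegatedRows M J)

    signs-rowWord : ∀ J → signs (rowWord J) ≗ withNegatedRows M J
    signs-rowWord J l = trans (cong sign (lookup∘tabulate _ l)) (sign-bit (withNegatedRows-sign M± J l))

    rowWord∈ : ∀ J → rowWord J ∈ codeOf M
    rowWord∈ J = signs⇒∈ (rowWord J) J (signs-rowWord J)

    enumeration : Enumeration (codeOf M)
    enumeration = record
      { word     = rowWord
      ; word∈    = rowWord∈
      ; complete = λ {w} w∈ → let J , eq = ∈⇒signs w w∈ in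
          J , signs-injective {x = rowWord J} {w} (λ l → trans (signs-rowWord J l) (sym (eq l)))
      }

    -- Supplies the pair of distinct codewords needed for a minimum distance to exist. The index in
    -- `Fin m` provides a coordinate where they differ; all words of length zero coincide.
    rowWord≢negated : ∀ j → Fin m → rowWord (j ↑ˡ n) ≢ rowWord (n ↑ʳ j)
    rowWord≢negated j l eq = sign≢neg (M± j l) (begin
      M j l                         ≡⟨ cong-app (lookup-++ˡ M _ j) l ⟨
      withNegatedRows M (j ↑ˡ n) l  ≡⟨ signs-rowWord (j ↑ˡ n) l ⟨
      signs (rowWord (j ↑ˡ n)) l    ≡⟨ cong (λ w → signs w l) eq ⟩
      signs (rowWord (n ↑ʳ j)) l    ≡⟨ signs-rowWord (n ↑ʳ j) l ⟩
      withNegatedRows M (n ↑ʳ j) l  ≡⟨ cong-app (lookup-++ʳ M _ j) l ⟩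
      - M j l                       ∎)
      where open ≡-Reasoning

-- Hadamard matrices with `b` columns deleted.

module DeletedColumns {n p b : ℕ} {H : Matrix n n} (hadamard : IsHadamard n H)
                      {σ : Fin p → Fin n} (σ-injective : Injective _≡_ _≡_ σ)
                      (n≡p+b : n ≡ p ℕ.+ b) (b²<p : b ℕ.* b ℕ.< p) where

  open IntegerSums
  open SignVectors
  open Words
  open import Data.Integer.Base using (_+_; _*_; _≤_; _<_)
  open IsHadamard hadamard
  open Hadamard hadamard

  M : Matrix n p
  M = keepColumns σ H

  open RowCode {M = M} (λ j l → entries j (σ l))

  -- Orthogonality of columns passes to the kept columns, since `σ` sends distinct indices to
  -- distinct columns.
  MᵀM≡nI : ∀ k l → (transpose M *ᴹ M) k l ≡ scalarMatrix (+ n) p k l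
  MᵀM≡nI k l with k ≟ l
  ... | yes refl = trans (HᵀH≡nI (σ k) (σ k)) (scalarMatrix-diagonal (+ n) (σ k))
  ... | no  k≢l  = trans (HᵀH≡nI (σ k) (σ l)) (scalarMatrix-off-diagonal (+ n) (k≢l ∘ σ-injective))

  -- Distinct codewords come from signed rows of `H` with nonpositive product. Deletion drops `b`
  -- summands, each at least -1, and so raises the product by at most `b`.
  codewords-∙ : ∀ {x y} → x ∈ codeOf M → y ∈ codeOf M → x ≢ y → signs x ∙ signs y ≤ + b
  codewords-∙ {x} {y} x∈ y∈ x≢y with ∈⇒signs x x∈ | ∈⇒signs y y∈
  ... | J , x≗ | K , y≗ with signedRows-product J K
  ...   | inj₁ J≗K = contradiction (signs-injective {x = x} {y} λ l → begin
    signs x l                  ≡⟨ x≗ l ⟩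
    withNegatedRows M J l      ≡⟨ withNegatedRows-keepColumns σ H J l ⟩
    withNegatedRows H J (σ l)  ≡⟨ J≗K (σ l) ⟩
    withNegatedRows H K (σ l)  ≡⟨ withNegatedRows-keepColumns σ H K l ⟨
    withNegatedRows M K l      ≡⟨ y≗ l ⟨
    signs y l                  ∎) x≢y
    where open ≡-Reasoning
  ...   | inj₂ JK≤0 = ℤₚ.≮⇒≥ λ b<xy → ℤₚ.<⇒≱ (ℤₚ.+-monoʳ-< (+ p) b<xy) (begin
    + p + signs x ∙ signs y
      ≡⟨ cong (_+_ (+ p)) (∙-cong {f = signs x} {g = signs y} (λ l → trans (x≗ l) (withNegatedRows-keepColumns σ H J l))
                                                               (λ l → trans (y≗ l) (withNegatedRows-keepColumns σ H K l))) ⟩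
    + p + sum (λ l → withNegatedRows H J (σ l) * withNegatedRows H K (σ l))
      ≤⟨ sum-injection-excess σ-injective
           (λ l → sign-product≥-1 (withNegatedRows-sign entries J l) (withNegatedRows-sign entries K l))
           JK≤0 ⟩
    + n
      ≡⟨ cong +_ n≡p+b ⟩
    + p + + b ∎)
    where open ℤₚ.≤-Reasoning

  -- By `parseval` the squared inner products of `v` with the `n` rows of `M` have average `p`,
  -- which is larger than `b * b`.
  codeword-near : 0 ℕ.< n → ∀ v → ∃[ c ] (c ∈ codeOf M × + b < signs v ∙ signs c)
  codeword-near 0<n v =
    let J , b< = signedRow-exceeding (+ p) (+ b) M (signs v) ∑≡np (subst (_< + p) (ℤₚ.pos-* b b) (ℤ.+<+ b²<p)) 0<n
    in rowWord J , rowWord∈ J ,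
       subst (+ b <_) (∙-cong {f = signs v} {g′ = signs (rowWord J)} (λ _ → refl) (λ l → sym (signs-rowWord J l))) b<
    where
    ∑≡np : sum (λ j → signs v ∙ M j * signs v ∙ M j) ≡ + n * + p
    ∑≡np = trans (parseval (+ n) M MᵀM≡nI (signs v))
                 (cong (+ n *_) (sign-vector-norm (sign-isSign ∘ lookup v)))

  codeOf-maximal : Fin n → Fin p → Maximal (codeOf M)
  codeOf-maximal j l = maximal enumeration (rowWord∈ (j ↑ˡ n)) (rowWord∈ (n ↑ʳ j)) (rowWord≢negated j l)
    λ v → let c , c∈ , b<vc = codeword-near (ℕₚ.≤-<-trans z≤n (Finₚ.toℕ<n j)) v in
      c , c∈ , λ {x} {y} x∈ y∈ x≢y →
        hamming-reverses-∙ x y v c (ℤₚ.≤-<-trans (codewords-∙ x∈ y∈ x≢y) b<vc)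

-- The numerical condition and the specialisation to `4 * i` deleted columns.

open import Data.Nat.Base using (_+_; _*_; _∸_; _^_; _≤_; _<_)

strictMono⇒injective : ∀ {m n} {σ : Fin m → Fin n} → σ Preserves Fin._<_ ⟶ Fin._<_ → Injective _≡_ _≡_ σ
strictMono⇒injective σ-mono {j} {k} eq with Finₚ.<-cmp j k
... | tri< j<k _ _ = contradiction (σ-mono j<k) (Finₚ.<-irrefl eq)
... | tri≈ _ j≡k _ = j≡k
... | tri> _ _ k<j = contradiction (σ-mono k<j) (Finₚ.<-irrefl (sym eq))

-- After division by 4 the claim is that four times the square of `i` is below `t`. As `i` is at
-- most its square, adding `i` to four squares gives at most five, and so at most sixteen.
16i²<4t : ∀ t i → 16 * i ^ 2 ∸ i < t → (4 * i) * (4 * i) < 4 * t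
16i²<4t t i 16i²∸i<t = begin-strict
  (4 * i) * (4 * i)         ≡⟨ ℕₚ.[m*n]*[o*p]≡[m*o]*[n*p] 4 i 4 i ⟩
  16 * (i * i)              ≡⟨ ℕₚ.*-assoc 4 4 (i * i) ⟩
  4 * (4 * (i * i))         ≤⟨ ℕₚ.*-monoʳ-≤ 4 4i²≤16i²∸i ⟩
  4 * (16 * i ^ 2 ∸ i)      <⟨ ℕₚ.*-monoʳ-< 4 16i²∸i<t ⟩
  4 * t                     ∎
  where
  open ℕₚ.≤-Reasoning
  i≤i*i : ∀ i → i ≤ i * i
  i≤i*i ℕ.zero    = z≤n
  i≤i*i (ℕ.suc i) = ℕₚ.m≤m*n (ℕ.suc i) (ℕ.suc i)
  4i²≤16i²∸i : 4 * (i * i) ≤ 16 * i ^ 2 ∸ i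
  4i²≤16i²∸i = begin
    4 * (i * i)               ≡⟨ ℕₚ.m+n∸n≡m _ i ⟨
    4 * (i * i) + i ∸ i       ≤⟨ ℕₚ.∸-monoˡ-≤ i (ℕₚ.+-monoʳ-≤ (4 * (i * i)) (i≤i*i i)) ⟩
    4 * (i * i) + i * i ∸ i   ≡⟨ cong (_∸ i) (ℕₚ.+-comm (4 * (i * i)) (i * i)) ⟩
    5 * (i * i) ∸ i           ≤⟨ ℕₚ.∸-monoˡ-≤ i (ℕₚ.*-monoˡ-≤ (i * i) (ℕₚ.m≤m+n 5 11)) ⟩
    16 * (i * i) ∸ i          ≡⟨ cong (λ j → 16 * (i * j) ∸ i) (ℕₚ.*-identityʳ i) ⟨
    16 * i ^ 2 ∸ i            ∎

theorem3 : ∀ (t i : ℕ) → 1 ≤ t → i < t → 16 * i ^ 2 ∸ i < t →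
    (H : Matrix (4 * t + 4 * i) (4 * t + 4 * i)) → IsHadamard (4 * t + 4 * i) H →
    (σ : Fin (4 * t) → Fin (4 * t + 4 * i)) → σ Preserves Fin._<_ ⟶ Fin._<_ →
    Maximal (codeOf (keepColumns σ H))
-- Here `p` is `4 * t` and `b` is `4 * i`. Matching `t` as a successor provides the row and the
-- column `zero`.
theorem3 t@(ℕ.suc _) i _ _ 16i²∸i<t H hadamard σ σ-mono =
  DeletedColumns.codeOf-maximal hadamard (strictMono⇒injective σ-mono) refl (16i²<4t t i 16i²∸i<t) zero zero
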